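{- Let $r\ge 1$ be an integer, let $V=\mathbb{F}_2^{2r}$, and write an element of $V$ as $(x_1,\ldots,x_r,y_1,\ldots,y_r)$. Define $q:V\to\mathbb{F}_2$ by $$q(x_1,\ldots,x_r,y_1,\ldots,y_r)=\sum_{i=1}^r x_iy_i.$$ Let $G=V\times\mathbb{F}_2$ (as an additive group) and $A=\{(x,q(x)):x\in V\}\subseteq G$. Then $|A|=2^{2r}$ and $$A-A=G\setminus\{(0,1)\}.$$ Moreover, $r_A(0,0)=|A|$ and $r_A(d)=\frac{|A|}{2}$ for every $d\in(A-A)\setminus\{(0,0)\}$. Consequently $r_A(d)\ge |A|/2$ for every $d\in A-A$. However, $A-A$ is neither a subgroup of $G$ nor a union of at most three cosets of any common subgroup of $G$ (i.e. there is no subgroup $K\le G$ such that $A-A$ is a union of at most three cosets of $K$).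
   Context: For a finite non-empty subset $A$ of an abelian group $G$, $A-A=\{a-a':a,a'\in A\}$ and $r_A(d)=|\{(a,a')\in A^2: a-a'=d\}|$ for $d\in G$. -}

module Defs where

open import Algebra.Bundles using (AbelianGroup)
import Algebra.Construct.DirectProduct as DirectProduct
import Algebra.Properties.CommutativeMonoid.Sum as Sum
open import Data.Fin.Base using (Fin; _↑ˡ_; _↑ʳ_)
open import Data.List.Base using (List; []; _∷_; length; map; filter; cartesianProduct; cartesianProductWith)
import Data.List.Membership.Propositional as List≡
import Data.List.Membership.Propositional.Properties as List≡
import Data.List.Membership.Setoid as Membership
import Data.List.Membership.Setoid.Properties as MembershipP
open import Data.List.Relation.Unary.All using ([]; _∷_)
open import Data.List.Relation.Unary.AllPairs using ([]; _∷_)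
open import Data.List.Relation.Unary.Any using (here; there)
import Data.List.Relation.Unary.Unique.Propositional as List≡
import Data.List.Relation.Unary.Unique.Propositional.Properties as Unique≡
open import Data.List.Relation.Unary.Unique.Setoid using (Unique)
import Data.List.Relation.Unary.Unique.Setoid.Properties as UniqueP
open import Data.Nat.Base using (ℕ; zero; suc; _+_; _≤_)
open import Data.Parity.Base as ℙ using (Parity; 0ℙ; 1ℙ)
import Data.Parity.Properties as ℙ
open import Data.Product.Base using (∃-syntax; Σ-syntax; _×_; _,_; proj₁)
open import Data.Product.Relation.Binary.Pointwise.NonDependent using (×-decidable)
open import Data.Vec.Base using (Vec; []; _∷_; zipWith; replicate; lookup)
import Data.Vec.Properties as Vec
open import Function.Base using (id)
open import Function.Bundles using (_⇔_; mk⇔)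
open import Level using (Level; 0ℓ; _⊔_) renaming (suc to lsuc)
open import Relation.Binary.Definitions using (Decidable)
open import Relation.Binary.PropositionalEquality
  using (_≡_; refl; cong₂; isEquivalence; setoid)
open import Relation.Unary using (Pred; _≐_; ⋃)

module AdditiveCombinatorics {c ℓ : Level} (G : AbelianGroup c ℓ) where

  -- The group operation of the bundle is written _∙_, its neutral element ε, and
  -- x - y is x ∙ y ⁻¹.
  open AbelianGroup G using (Carrier; _≈_; _∙_; ε; _⁻¹; _-_) renaming (setoid to S)
  open Membership S using (_∈_)

  record FiniteNonEmptySubset p : Set (c ⊔ ℓ ⊔ lsuc p) where
    field
      Member   : Pred Carrier p
      elements : List Carrier
      unique   : Unique S elements
      member   : ∀ {x} → x ∈ elements ⇔ Member x
      nonEmpty : ∃[ x ] Member x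

    card : ℕ
    card = length elements

  open FiniteNonEmptySubset public

  infixl 6 _⊝_

  _⊝_ : ∀ {p q} → Pred Carrier p → Pred Carrier q → Pred Carrier (c ⊔ ℓ ⊔ p ⊔ q)
  (P ⊝ Q) d = ∃[ a ] ∃[ a′ ] P a × Q a′ × d ≈ a - a′

  -- r_A(d). Since elements A lists every element of A exactly once up to _≈_, the
  -- cartesian product lists every pair in A × A exactly once; decidability of
  -- _≈_ is only used to count.
  rep : ∀ {p} → Decidable _≈_ → FiniteNonEmptySubset p → Carrier → ℕ
  rep _≟_ A d =
    length (filter (λ (a , a′) → (a - a′) ≟ d) (cartesianProduct (elements A) (elements A)))

  record IsSubgroup {p} (H : Pred Carrier p) : Set (c ⊔ ℓ ⊔ p) where
    field
      resp      : ∀ {x y} → x ≈ y → H x → H y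
      ε-closed  : H ε
      ∙-closed  : ∀ {x y} → H x → H y → H (x ∙ y)
      ⁻¹-closed : ∀ {x} → H x → H (x ⁻¹)

  Coset : ∀ {p} → Carrier → Pred Carrier p → Pred Carrier (c ⊔ ℓ ⊔ p)
  Coset g K x = ∃[ k ] K k × x ≈ g ∙ k

  -- The representatives g i need not be distinct, nor m positive.
  IsUnionOfCosets≤ : ∀ {p q} → ℕ → Pred Carrier q → Pred Carrier p → Set (c ⊔ ℓ ⊔ p ⊔ q)
  IsUnionOfCosets≤ n K P =
    ∃[ m ] m ≤ n × (Σ[ g ∈ (Fin m → Carrier) ] P ≐ ⋃ (Fin m) (λ i → Coset (g i) K))

-- ℙ._+_ is addition modulo 2 (and every element is its own negative).
𝔽₂ : Set
𝔽₂ = Parity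

open Sum (AbelianGroup.commutativeMonoid ℙ.+-0-abelianGroup) public using (sum)

vecAbelianGroup : ℕ → AbelianGroup 0ℓ 0ℓ
vecAbelianGroup n = record
  { Carrier = Vec 𝔽₂ n
  ; _≈_     = _≡_
  ; _∙_     = zipWith ℙ._+_
  ; ε       = replicate n 0ℙ
  ; _⁻¹     = id
  ; isAbelianGroup = record
    { isGroup = record
      { isMonoid = record
        { isSemigroup = record
          { isMagma = record { isEquivalence = isEquivalence ; ∙-cong = cong₂ (zipWith ℙ._+_) }
          ; assoc   = Vec.zipWith-assoc ℙ.+-assoc
          }
        ; identity = Vec.zipWith-identityˡ ℙ.+-identityˡ , Vec.zipWith-identityʳ ℙ.+-identityʳ
        }
      ; inverse = self-inverse , self-inverse
      ; ⁻¹-cong = id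
      }
    ; comm = Vec.zipWith-comm ℙ.+-comm
    }
  }
  where
  self-inverse : ∀ {n} (v : Vec 𝔽₂ n) → zipWith ℙ._+_ v v ≡ replicate n 0ℙ
  self-inverse []      = refl
  self-inverse (x ∷ v) = cong₂ _∷_ (ℙ.p+p≡0ℙ x) (self-inverse v)

allVectors : ∀ n → List (Vec 𝔽₂ n)
allVectors zero    = [] ∷ []
allVectors (suc n) = cartesianProductWith _∷_ (0ℙ ∷ 1ℙ ∷ []) (allVectors n)

allVectors-complete : ∀ {n} (v : Vec 𝔽₂ n) → v List≡.∈ allVectors n
allVectors-complete []      = here refl
allVectors-complete (x ∷ v) =
  List≡.∈-cartesianProductWith⁺ _∷_ (bit x) (allVectors-complete v)
  where
  bit : ∀ x → x List≡.∈ (0ℙ ∷ 1ℙ ∷ [])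
  bit 0ℙ = here refl
  bit 1ℙ = there (here refl)

allVectors-unique : ∀ n → List≡.Unique (allVectors n)
allVectors-unique zero    = [] ∷ []
allVectors-unique (suc n) =
  Unique≡.cartesianProductWith⁺ _∷_ Vec.∷-injective
    (((λ ()) ∷ []) ∷ [] ∷ []) (allVectors-unique n)

-- V = 𝔽₂^{2r}; the first r coordinates of v are x₁ … x_r, the last r are
-- y₁ … y_r.
V : ℕ → Set
V r = Vec 𝔽₂ (r + r)

q : ∀ r → V r → 𝔽₂
q r v = sum {r} (λ i → x i ℙ.* y i)
  where
  x y : Fin r → 𝔽₂
  x i = lookup v (i ↑ˡ r)
  y i = lookup v (r ↑ʳ i)

-- The additive group G = V × 𝔽₂, with componentwise propositional equality.
𝔾 : ℕ → AbelianGroup 0ℓ 0ℓ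
𝔾 r = DirectProduct.abelianGroup (vecAbelianGroup (r + r)) ℙ.+-0-abelianGroup

≈-dec : ∀ r → Decidable (AbelianGroup._≈_ (𝔾 r))
≈-dec r = ×-decidable (Vec.≡-dec ℙ._≟_) ℙ._≟_

0V : ∀ r → V r
0V r = replicate (r + r) 0ℙ

module _ (r : ℕ) where
  open AbelianGroup (𝔾 r) using (_≈_) renaming (setoid to S)
  open AdditiveCombinatorics (𝔾 r)

  -- A = {(v , q(v)) : v ∈ V}.
  graph : FiniteNonEmptySubset 0ℓ
  graph = record
    { Member   = λ g → ∃[ v ] g ≈ (v , q r v)
    ; elements = map (λ v → v , q r v) (allVectors (r + r))
    ; unique   = UniqueP.map⁺ (setoid (V r)) S proj₁ (allVectors-unique (r + r))
    ; member   = mk⇔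
        (λ g∈ → let v , _ , eq = MembershipP.∈-map⁻ (setoid (V r)) S g∈ in v , eq)
        (λ { (v , refl , refl) → MembershipP.∈-map⁺ (setoid (V r)) S
               (λ { refl → refl , refl }) (allVectors-complete v) })
    ; nonEmpty = (0V r , q r (0V r)) , 0V r , refl , refl
    }

{-# OPTIONS --safe #-}

-- Over 𝔽₂ we have x - y = x + y, so r_A(u , s) counts the v ∈ V with
-- q(v) + q(v + u) = s. If u ≠ 0, choose a coordinate j with u_j = 1 and let k be the
-- other coordinate of the pair {x_i , y_i} containing j. Flipping v_k adds v_j to q(v)
-- and v_j + 1 to q(v + u), so this involution exchanges the solutions for s = 0 with
-- those for s = 1, and each of the two values is attained half of the time. If u = 0,
-- then q(v) + q(v + u) is constantly 0. Finally, if A - A is a union of cosets of K,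
-- so is its complement {(0 , 1)}; hence K is trivial, and more than three cosets
-- are needed since A - A has at least four elements.
module Submission where

open import Defs
open import Algebra.Bundles using (AbelianGroup)
import Algebra.Properties.CommutativeMonoid.Sum as Sum
import Algebra.Properties.Group as GroupProperties
open import Data.Fin.Base using (Fin; zero; suc; splitAt; _↑ˡ_; _↑ʳ_)
open import Data.Fin.Patterns using (0F; 1F; 2F; 3F)
import Data.Fin.Properties as Fin
open import Data.List.Base using (List; []; _∷_; _++_; length; map; filter; cartesianProduct)
import Data.List.Membership.Propositional as List
import Data.List.Membership.Propositional.Properties as List
open import Data.List.Membership.Propositional.Properties.WithK using (unique∧set⇒bag)
import Data.List.Properties as List
open import Data.List.Relation.Binary.BagAndSetEquality using (∼bag⇒↭)
open import Data.List.Relation.Binary.Permutation.Propositional.Properties using (↭-length)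
import Data.List.Relation.Unary.All as All
open import Data.List.Relation.Unary.Unique.Propositional using (Unique)
import Data.List.Relation.Unary.Unique.Propositional.Properties as Unique
open import Data.Nat.Base as ℕ using (ℕ; zero; suc; _≤_; _≥_; s≤s; _*_; _^_)
import Data.Nat.Properties as ℕ
open import Data.Parity.Base as ℙ using (0ℙ; 1ℙ)
import Data.Parity.Properties as ℙ
open import Data.Product.Base using (∃-syntax; _×_; _,_; proj₁; proj₂; Σ-syntax)
open import Data.Sum.Base using (inj₁; inj₂)
open import Data.Vec.Base using (Vec; []; _∷_; zipWith; replicate; lookup; updateAt)
import Data.Vec.Properties as Vec
open import Function.Base using (_∘_)
open import Function.Bundles using (mk⇔)
open import Function.Definitions using (Injective)
open import Level using (0ℓ)
open import Relation.Binary.PropositionalEquality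
open import Relation.Nullary using (¬_; yes; no; contradiction)
open import Relation.Unary using (Pred; _∈_; _≐_)

-- Counting the fibres of a two-valued function on a list.

module _ {a} {A : Set a} where

  -- Membership proofs in a duplicate-free list are unique, so equality as sets is already equality
  -- as bags, and bag-equal lists are permutations of each other.
  length-unique-⊆⊇ : {xs ys : List A} → Unique xs → Unique ys →
                     (∀ {x} → x List.∈ xs → x List.∈ ys) →
                     (∀ {x} → x List.∈ ys → x List.∈ xs) →
                     length xs ≡ length ys
  length-unique-⊆⊇ xs! ys! xs⊆ys ys⊆xs =
    ↭-length (∼bag⇒↭ (unique∧set⇒bag xs! ys! (mk⇔ xs⊆ys ys⊆xs)))

  count : (A → 𝔽₂) → 𝔽₂ → List A → ℕ
  count f s xs = length (filter (λ x → f x ℙ.≟ s) xs)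

  count-complement : ∀ f s xs → count f s xs ℕ.+ count f (s ℙ.⁻¹) xs ≡ length xs
  count-complement f s []       = refl
  count-complement f s (x ∷ xs) with ih ← count-complement f s xs | f x | s
  ... | 0ℙ | 0ℙ = cong suc ih
  ... | 1ℙ | 1ℙ = cong suc ih
  ... | 0ℙ | 1ℙ = trans (ℕ.+-suc _ _) (cong suc ih)
  ... | 1ℙ | 0ℙ = trans (ℕ.+-suc _ _) (cong suc ih)

  module _ {f : A → 𝔽₂} {φ : A → A} (φ-involutive : ∀ x → φ (φ x) ≡ x)
           (f∘φ : ∀ x → f (φ x) ≡ f x ℙ.⁻¹)
           {xs : List A} (xs! : Unique xs) (complete : ∀ x → x List.∈ xs) where

    -- The involution `φ` carries one fibre of `f` bijectively onto the other: it is injective, and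
    -- each `x` is the image of `φ x`. Here `ℙ._⁻¹` is the exchange of `0ℙ` and `1ℙ`, that is,
    -- addition of 1.
    count-flip : ∀ s → count f s xs ≡ count f (s ℙ.⁻¹) xs
    count-flip s = trans (sym (List.length-map φ (filter P? xs)))
      (length-unique-⊆⊇ (Unique.map⁺ φ-injective (Unique.filter⁺ P? xs!))
                        (Unique.filter⁺ Q? xs!) to from)
      where
      P? = λ x → f x ℙ.≟ s
      Q? = λ x → f x ℙ.≟ s ℙ.⁻¹

      φ-injective : ∀ {x y} → φ x ≡ φ y → x ≡ y
      φ-injective eq = trans (sym (φ-involutive _)) (trans (cong φ eq) (φ-involutive _))

      to : ∀ {x} → x List.∈ map φ (filter P? xs) → x List.∈ filter Q? xs
      to x∈ with y , y∈ , refl ← List.∈-map⁻ φ x∈ = List.∈-filter⁺ Q? (complete _)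
        (trans (f∘φ y) (cong ℙ._⁻¹ (proj₂ (List.∈-filter⁻ P? {xs = xs} y∈))))

      from : ∀ {x} → x List.∈ filter Q? xs → x List.∈ map φ (filter P? xs)
      from {x} x∈ = subst (List._∈ _) (φ-involutive x)
        (List.∈-map⁺ φ (List.∈-filter⁺ P? (complete _)
          (trans (f∘φ x) (trans (cong ℙ._⁻¹ fx≡s⁻¹) (ℙ.⁻¹-involutive s)))))
        where
        fx≡s⁻¹ : f x ≡ s ℙ.⁻¹
        fx≡s⁻¹ = proj₂ (List.∈-filter⁻ Q? {xs = xs} x∈)

    2*count≡length : ∀ s → 2 * count f s xs ≡ length xs
    2*count≡length s = begin
      2 * count f s xs                            ≡⟨ cong (count f s xs ℕ.+_) (ℕ.+-identityʳ _) ⟩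
      count f s xs ℕ.+ count f s xs               ≡⟨ cong (count f s xs ℕ.+_) (count-flip s) ⟩
      count f s xs ℕ.+ count f (s ℙ.⁻¹) xs        ≡⟨ count-complement f s xs ⟩
      length xs                                   ∎
      where open ≡-Reasoning

-- Vectors over 𝔽₂ and flips of a single coordinate.

length-allVectors : ∀ n → length (allVectors n) ≡ 2 ^ n
length-allVectors zero    = refl
length-allVectors (suc n) = begin
  length (map (0ℙ ∷_) vs ++ map (1ℙ ∷_) vs ++ [])           ≡⟨ List.length-++ (map (0ℙ ∷_) vs) ⟩
  length (map (0ℙ ∷_) vs) ℕ.+ length (map (1ℙ ∷_) vs ++ [])
    ≡⟨ cong₂ ℕ._+_ (List.length-map _ vs)
         (trans (List.length-++ (map (1ℙ ∷_) vs)) (cong (ℕ._+ 0) (List.length-map _ vs))) ⟩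
  2 * length vs                                             ≡⟨ cong (2 *_) (length-allVectors n) ⟩
  2 ^ suc n                                                 ∎
  where
  open ≡-Reasoning
  vs = allVectors n

infixl 6 _⊕_

_⊕_ : ∀ {n} → Vec 𝔽₂ n → Vec 𝔽₂ n → Vec 𝔽₂ n
_⊕_ = zipWith ℙ._+_

module _ {n : ℕ} where
  open AbelianGroup (vecAbelianGroup n) public
    using () renaming (inverseʳ to ⊕-self; identityʳ to ⊕-identityʳ)
  open GroupProperties (AbelianGroup.group (vecAbelianGroup n)) public
    using () renaming (\\-leftDividesʳ to ⊕-cancel; x∙y⁻¹≈ε⇒x≈y to ⊕≡0⇒≡)

nonzero-coordinate : ∀ {n} (u : Vec 𝔽₂ n) → u ≢ replicate n 0ℙ → ∃[ j ] lookup u j ≡ 1ℙ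
nonzero-coordinate []       u≢0 = contradiction refl u≢0
nonzero-coordinate (1ℙ ∷ u) u≢0 = zero , refl
nonzero-coordinate (0ℙ ∷ u) u≢0 with j , eq ← nonzero-coordinate u (u≢0 ∘ cong (0ℙ ∷_)) =
  suc j , eq

flip : ∀ {n} → Fin n → Vec 𝔽₂ n → Vec 𝔽₂ n
flip k v = updateAt v k ℙ._⁻¹

flip-involutive : ∀ {n} (k : Fin n) v → flip k (flip k v) ≡ v
flip-involutive k v =
  trans (Vec.updateAt-updateAt k v) (Vec.updateAt-id-local k v (ℙ.⁻¹-involutive _))

flip-⊕ : ∀ {n} (k : Fin n) u v → flip k u ⊕ v ≡ flip k (u ⊕ v)
flip-⊕ zero    (0ℙ ∷ u) (y ∷ v) = refl
flip-⊕ zero    (1ℙ ∷ u) (y ∷ v) = cong (_∷ _) (sym (ℙ.⁻¹-involutive y))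
flip-⊕ (suc k) (x ∷ u)  (y ∷ v) = cong (_ ∷_) (flip-⊕ k u v)

-- Effect of one changed factor on a sum of products.

open Sum ℙ.+-0-commutativeMonoid using (sum-cong-≗)

sum-update : ∀ {n} (f g : Fin n → 𝔽₂) i {δ} →
             g i ≡ f i ℙ.+ δ → (∀ j → j ≢ i → g j ≡ f j) → sum g ≡ sum f ℙ.+ δ
sum-update f g zero {δ} at-i off-i = begin
  g zero ℙ.+ sum (g ∘ suc)             ≡⟨ cong₂ ℙ._+_ at-i (sum-cong-≗ (λ j → off-i (suc j) (λ ()))) ⟩
  f zero ℙ.+ δ ℙ.+ sum (f ∘ suc)       ≡⟨ ℙ.+-assoc (f zero) δ _ ⟩
  f zero ℙ.+ (δ ℙ.+ sum (f ∘ suc))     ≡⟨ cong (f zero ℙ.+_) (ℙ.+-comm δ _) ⟩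
  f zero ℙ.+ (sum (f ∘ suc) ℙ.+ δ)     ≡⟨ ℙ.+-assoc (f zero) _ δ ⟨
  f zero ℙ.+ sum (f ∘ suc) ℙ.+ δ       ∎
  where open ≡-Reasoning
sum-update f g (suc i) {δ} at-i off-i = begin
  g zero ℙ.+ sum (g ∘ suc)             ≡⟨ cong₂ ℙ._+_ (off-i zero (λ ()))
                                            (sum-update (f ∘ suc) (g ∘ suc) i at-i
                                              (λ j j≢i → off-i (suc j) (j≢i ∘ Fin.suc-injective))) ⟩
  f zero ℙ.+ (sum (f ∘ suc) ℙ.+ δ)     ≡⟨ ℙ.+-assoc (f zero) _ δ ⟨
  f zero ℙ.+ sum (f ∘ suc) ℙ.+ δ       ∎
  where open ≡-Reasoning

↑ˡ≢↑ʳ : ∀ {m n} (i : Fin m) (j : Fin n) → i ↑ˡ n ≢ m ↑ʳ j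
↑ˡ≢↑ʳ {m} {n} i j eq
  with () ← trans (sym (Fin.splitAt-↑ˡ m i n)) (trans (cong (splitAt m) eq) (Fin.splitAt-↑ʳ m n j))

-- Distributivity, with `a ℙ.⁻¹` read as a + 1.
⁻¹-*ˡ : ∀ a b → a ℙ.⁻¹ ℙ.* b ≡ a ℙ.* b ℙ.+ b
⁻¹-*ˡ 0ℙ b = refl
⁻¹-*ˡ 1ℙ b = sym (ℙ.p+p≡0ℙ b)

⁻¹-*ʳ : ∀ a b → a ℙ.* b ℙ.⁻¹ ≡ a ℙ.* b ℙ.+ a
⁻¹-*ʳ a b = trans (ℙ.*-comm a (b ℙ.⁻¹)) (trans (⁻¹-*ˡ b a) (cong (ℙ._+ a) (ℙ.*-comm b a)))

-- Unions of cosets in an arbitrary abelian group.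

module _ {c ℓ} (G : AbelianGroup c ℓ) where
  open AbelianGroup G renaming (sym to ≈-sym; trans to ≈-trans)
  open AdditiveCombinatorics G

  -- Multiplying by an element of `K` does not leave a coset: if `x ≈ g i ∙ k′`, then
  -- `x ∙ k ≈ g i ∙ (k′ ∙ k)`.
  coset-union-absorbs : ∀ {p q n} {K : Pred Carrier p} {P : Pred Carrier q} →
                        IsSubgroup K → IsUnionOfCosets≤ n K P →
                        ∀ {x k} → x ∈ P → k ∈ K → x ∙ k ∈ P
  coset-union-absorbs K≤G (_ , _ , g , P⊆∪ , ∪⊆P) x∈P k∈K with i , k′ , k′∈K , x≈ ← P⊆∪ x∈P =
    ∪⊆P (i , _ , IsSubgroup.∙-closed K≤G k′∈K k∈K , ≈-trans (∙-congʳ x≈) (assoc _ _ _))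

  -- Cosets of a trivial `K` are single points, so every `f i` equals one of the at most `n`
  -- representatives, and by the pigeonhole principle two of the `n + 1` values share one.
  trivial-coset-union-small : ∀ {p q n} {K : Pred Carrier p} {P : Pred Carrier q} →
                              (∀ {k} → k ∈ K → k ≈ ε) → IsUnionOfCosets≤ n K P →
                              {f : Fin (suc n) → Carrier} → (∀ i → f i ∈ P) →
                              ¬ Injective _≡_ _≈_ f
  trivial-coset-union-small K≈ε (m , m≤n , g , P⊆∪ , _) {f} f∈P f-injective
    with i , j , i<j , same ← Fin.pigeonhole (s≤s m≤n) (λ i → proj₁ (P⊆∪ (f∈P i))) =
    Fin.<⇒≢ i<j (f-injective
      (≈-trans (f≈g i) (≈-trans (reflexive (cong g same)) (≈-sym (f≈g j)))))
    where
    f≈g : ∀ i → f i ≈ g (proj₁ (P⊆∪ (f∈P i)))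
    f≈g i with _ , _ , k∈K , fᵢ≈ ← P⊆∪ (f∈P i) =
      ≈-trans fᵢ≈ (≈-trans (∙-congˡ (K≈ε k∈K)) (identityʳ _))

-- The quadratic form and its derivatives.

module _ (r : ℕ) where

  q-flip-x : ∀ i v → q r (flip (i ↑ˡ r) v) ≡ q r v ℙ.+ lookup v (r ↑ʳ i)
  q-flip-x i v = sum-update _ _ i
    (trans (cong₂ ℙ._*_ (Vec.lookup∘updateAt (i ↑ˡ r) v)
                        (Vec.lookup∘updateAt′ _ _ (↑ˡ≢↑ʳ i i ∘ sym) v))
           (⁻¹-*ˡ (lookup v (i ↑ˡ r)) _))
    (λ j j≢i → cong₂ ℙ._*_ (Vec.lookup∘updateAt′ _ _ (j≢i ∘ Fin.↑ˡ-injective r j i) v)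
                           (Vec.lookup∘updateAt′ _ _ (↑ˡ≢↑ʳ i j ∘ sym) v))

  q-flip-y : ∀ i v → q r (flip (r ↑ʳ i) v) ≡ q r v ℙ.+ lookup v (i ↑ˡ r)
  q-flip-y i v = sum-update _ _ i
    (trans (cong₂ ℙ._*_ (Vec.lookup∘updateAt′ _ _ (↑ˡ≢↑ʳ i i) v)
                        (Vec.lookup∘updateAt (r ↑ʳ i) v))
           (⁻¹-*ʳ (lookup v (i ↑ˡ r)) _))
    (λ j j≢i → cong₂ ℙ._*_ (Vec.lookup∘updateAt′ _ _ (↑ˡ≢↑ʳ j i) v)
                           (Vec.lookup∘updateAt′ _ _ (j≢i ∘ Fin.↑ʳ-injective r j i) v))

  -- The coordinate `k` is the partner of `j` in the product x_i y_i; adding 1 to one factor adds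
  -- the other factor to that product and leaves the remaining summands alone.
  dual-coordinate : ∀ j → ∃[ k ] ∀ v → q r (flip k v) ≡ q r v ℙ.+ lookup v j
  dual-coordinate j with splitAt r j in eq
  ... | inj₁ i rewrite sym (Fin.splitAt⁻¹-↑ˡ eq) = r ↑ʳ i , q-flip-y i
  ... | inj₂ i rewrite sym (Fin.splitAt⁻¹-↑ʳ eq) = i ↑ˡ r , q-flip-x i

  -- The discrete derivative of `q` in direction `u`. It is the second component of the difference
  -- of the graph points over `v` and `v ⊕ u`, whose first component is `u`.
  derivative : V r → V r → 𝔽₂
  derivative u v = q r v ℙ.+ q r (v ⊕ u)

  derivative-0 : ∀ v → derivative (0V r) v ≡ 0ℙ
  derivative-0 v = trans (cong (λ w → q r v ℙ.+ q r w) (⊕-identityʳ v)) (ℙ.p+p≡0ℙ (q r v))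

  -- With u_j = 1 and `k` dual to `j`, flipping v_k changes q(v) by v_j and q(v + u) by v_j + u_j =
  -- v_j + 1; the total change is 1.
  derivative-flip : ∀ {u} → u ≢ 0V r →
                    ∃[ k ] ∀ v → derivative u (flip k v) ≡ derivative u v ℙ.⁻¹
  derivative-flip {u} u≢0
    with j , uⱼ≡1 ← nonzero-coordinate u u≢0
    with k , q-flip ← dual-coordinate j = k , λ v → begin
      q r (flip k v) ℙ.+ q r (flip k v ⊕ u)
        ≡⟨ cong₂ ℙ._+_ (q-flip v) (trans (cong (q r) (flip-⊕ k v u)) (q-flip (v ⊕ u))) ⟩
      q r v ℙ.+ lookup v j ℙ.+ (q r (v ⊕ u) ℙ.+ lookup (v ⊕ u) j)
        ≡⟨ cong (λ c → q r v ℙ.+ lookup v j ℙ.+ (q r (v ⊕ u) ℙ.+ c))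
             (trans (Vec.lookup-zipWith ℙ._+_ j v u) (cong (lookup v j ℙ.+_) uⱼ≡1)) ⟩
      q r v ℙ.+ lookup v j ℙ.+ (q r (v ⊕ u) ℙ.+ (lookup v j ℙ.+ 1ℙ))
        ≡⟨ regroup (q r v) (q r (v ⊕ u)) (lookup v j) ⟩
      derivative u v ℙ.⁻¹
        ∎
    where
    open ≡-Reasoning

    regroup : ∀ a b c → a ℙ.+ c ℙ.+ (b ℙ.+ (c ℙ.+ 1ℙ)) ≡ (a ℙ.+ b) ℙ.⁻¹
    regroup 0ℙ 0ℙ 0ℙ = refl
    regroup 0ℙ 0ℙ 1ℙ = refl
    regroup 0ℙ 1ℙ 0ℙ = refl
    regroup 0ℙ 1ℙ 1ℙ = refl
    regroup 1ℙ 0ℙ 0ℙ = refl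
    regroup 1ℙ 0ℙ 1ℙ = refl
    regroup 1ℙ 1ℙ 0ℙ = refl
    regroup 1ℙ 1ℙ 1ℙ = refl

  -- The zero vector and its flip give opposite values, so one of them gives `s`.
  derivative-surjective : ∀ {u} → u ≢ 0V r → ∀ s → ∃[ v ] derivative u v ≡ s
  derivative-surjective {u} u≢0 s
    with k , D-flip ← derivative-flip u≢0
    with derivative u (0V r) ℙ.≟ s
  ... | yes eq = 0V r , eq
  ... | no neq = flip k (0V r) , trans (D-flip (0V r)) (≢⇒⁻¹≡ _ _ neq)
    where
    ≢⇒⁻¹≡ : ∀ a b → a ≢ b → a ℙ.⁻¹ ≡ b
    ≢⇒⁻¹≡ 0ℙ 0ℙ a≢b = contradiction refl a≢b
    ≢⇒⁻¹≡ 0ℙ 1ℙ a≢b = refl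
    ≢⇒⁻¹≡ 1ℙ 0ℙ a≢b = refl
    ≢⇒⁻¹≡ 1ℙ 1ℙ a≢b = contradiction refl a≢b

  -- Representation counts and the difference set of the graph.

  open AbelianGroup (𝔾 r) using (Carrier; _≈_; _-_)
  open AdditiveCombinatorics (𝔾 r)

  private
    A     = graph r
    A-A   = Member A ⊝ Member A
    r_A   = rep (≈-dec r) A
    all   = allVectors (r ℕ.+ r)

    point : V r → Carrier
    point v = v , q r v

  -- A pair of graph points with difference `(u , s)` is determined by the first one: over `v` and
  -- `v ⊕ u`, with derivative `s` at `v`.
  rep≡count : ∀ u s → r_A (u , s) ≡ count (derivative u) s all
  rep≡count u s = trans
    (length-unique-⊆⊇ (Unique.filter⁺ P? (Unique.cartesianProduct⁺ points! points!))
                      (Unique.map⁺ (cong (proj₁ ∘ proj₁)) (Unique.filter⁺ Q? (allVectors-unique _)))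
                      to from)
    (List.length-map pair (filter Q? all))
    where
    P? = λ ((a , a′) : Carrier × Carrier) → ≈-dec r (a - a′) (u , s)
    Q? = λ v → derivative u v ℙ.≟ s

    pair : V r → Carrier × Carrier
    pair v = point v , point (v ⊕ u)

    points! : Unique (elements A)
    points! = Unique.map⁺ (cong proj₁) (allVectors-unique _)

    to : ∀ {x} → x List.∈ filter P? (cartesianProduct (elements A) (elements A)) →
         x List.∈ map pair (filter Q? all)
    to x∈
      with x∈A×A , refl , refl ← List.∈-filter⁻ P? {xs = cartesianProduct (elements A) (elements A)} x∈
      with a∈ , a′∈ ← List.∈-cartesianProduct⁻ (elements A) (elements A) x∈A×A
      with v , _ , refl ← List.∈-map⁻ point a∈
      with w , _ , refl ← List.∈-map⁻ point a′∈ =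
      -- At this point `u` has been unified with `v ⊕ w`, so `pair v` has second entry over
      -- `v ⊕ (v ⊕ w)`, which is `w`.
      subst (λ w′ → (point v , point w′) List.∈ map pair (filter Q? all)) (⊕-cancel v w)
        (List.∈-map⁺ pair (List.∈-filter⁺ Q? (allVectors-complete v)
          (cong (λ w′ → q r v ℙ.+ q r w′) (⊕-cancel v w))))

    from : ∀ {x} → x List.∈ map pair (filter Q? all) →
           x List.∈ filter P? (cartesianProduct (elements A) (elements A))
    from x∈ with v , v∈ , refl ← List.∈-map⁻ pair x∈ =
      List.∈-filter⁺ P?
        (List.∈-cartesianProduct⁺ (List.∈-map⁺ point (allVectors-complete v))
                                  (List.∈-map⁺ point (allVectors-complete (v ⊕ u))))
        (⊕-cancel v u , proj₂ (List.∈-filter⁻ Q? {xs = all} v∈))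

  card-A : card A ≡ length all
  card-A = List.length-map point all

  rep-0 : r_A (0V r , 0ℙ) ≡ card A
  rep-0 = begin
    r_A (0V r , 0ℙ)                   ≡⟨ rep≡count (0V r) 0ℙ ⟩
    count (derivative (0V r)) 0ℙ all  ≡⟨ cong length (List.filter-all _ (All.universal derivative-0 all)) ⟩
    length all                        ≡⟨ card-A ⟨
    card A                            ∎
    where open ≡-Reasoning

  2*rep : ∀ {u} → u ≢ 0V r → ∀ s → 2 * r_A (u , s) ≡ card A
  2*rep {u} u≢0 s with k , D-flip ← derivative-flip u≢0 = begin
    2 * r_A (u , s)                   ≡⟨ cong (2 *_) (rep≡count u s) ⟩
    2 * count (derivative u) s all    ≡⟨ 2*count≡length {φ = flip k} (flip-involutive k) D-flip
                                           (allVectors-unique _) allVectors-complete s ⟩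
    length all                        ≡⟨ card-A ⟨
    card A                            ∎
    where open ≡-Reasoning

  -- Two graph points with the same first component coincide, so their difference has second
  -- component 0.
  A-A⊆ : ∀ {d} → d ∈ A-A → ¬ (d ≈ (0V r , 1ℙ))
  A-A⊆ (_ , _ , (v , refl , refl) , (w , refl , refl) , refl , refl) (v⊕w≡0 , qv+qw≡1)
    with refl ← ⊕≡0⇒≡ v w v⊕w≡0
    with () ← trans (sym (ℙ.p+p≡0ℙ (q r v))) qv+qw≡1

  -- Over `u = 0` only the zero element remains, the difference of a point with itself; over `u ≢ 0`
  -- the derivative attains both values.
  A-A⊇ : ∀ {d} → ¬ (d ≈ (0V r , 1ℙ)) → d ∈ A-A
  A-A⊇ {u , s} d≉ with Vec.≡-dec ℙ._≟_ u (0V r) | s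
  ... | yes refl | 1ℙ = contradiction (refl , refl) d≉
  ... | yes refl | 0ℙ = _ , _ , (0V r , refl , refl) , (0V r , refl , refl) ,
                        sym (⊕-self (0V r)) , sym (ℙ.p+p≡0ℙ (q r (0V r)))
  ... | no u≢0   | s with v , refl ← derivative-surjective u≢0 s =
    _ , _ , (v , refl , refl) , (v ⊕ u , refl , refl) , sym (⊕-cancel v u) , refl

  2*rep-nonzero : ∀ d → d ∈ A-A → ¬ (d ≈ (0V r , 0ℙ)) → 2 * r_A d ≡ card A
  2*rep-nonzero (u , s) d∈ d≉0 = 2*rep (u≢0 s d∈ d≉0) s
    where
    u≢0 : ∀ s → (u , s) ∈ A-A → ¬ ((u , s) ≈ (0V r , 0ℙ)) → u ≢ 0V r
    u≢0 0ℙ d∈ d≉0 u≡0 = d≉0 (u≡0 , refl)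
    u≢0 1ℙ d∈ d≉0 u≡0 = A-A⊆ d∈ (u≡0 , refl)

  card≤2*rep : ∀ d → d ∈ A-A → card A ≤ 2 * r_A d
  card≤2*rep d d∈ with ≈-dec r d (0V r , 0ℙ)
  ... | yes (refl , refl) = subst (λ n → card A ≤ 2 * n) (sym rep-0) (ℕ.m≤n*m (card A) 2)
  ... | no d≉0            = ℕ.≤-reflexive (sym (2*rep-nonzero d d∈ d≉0))

  -- Neither a subgroup nor a union of few cosets.

  ¬subgroup : r ≥ 1 → ¬ IsSubgroup A-A
  ¬subgroup (s≤s {n = r′} _) S =
    -- Since `e` is nonzero, `(e , 0ℙ)` and `(e , 1ℙ)` both lie in `A-A`, but their sum is the
    -- missing element.
    A-A⊆ (∙-closed (A-A⊇ {e , 0ℙ} λ { (() , _) }) (A-A⊇ {e , 1ℙ} λ { (() , _) }))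
         (⊕-self e , refl)
    where
    open IsSubgroup S
    e = 1ℙ ∷ replicate _ 0ℙ

  -- If `k` in `K` were nonzero, then t + k would differ from the missing element `t` and so lie in
  -- `A-A`; subtracting `k` stays inside `A-A` and gives back `t`.
  trivial-stabiliser : ∀ {K : Pred Carrier 0ℓ} {n} → IsSubgroup K → IsUnionOfCosets≤ n K A-A →
                       ∀ {k} → K k → k ≈ (0V r , 0ℙ)
  trivial-stabiliser K≤G A-A≐∪ {k} k∈K with ≈-dec r k (0V r , 0ℙ)
  ... | yes k≈0 = k≈0
  ... | no  k≉0 = contradiction (//-rightDividesʳ k t)
    (A-A⊆ (coset-union-absorbs (𝔾 r) K≤G A-A≐∪ (A-A⊇ (k≉0 ∘ identityʳ-unique t k))
      (IsSubgroup.⁻¹-closed K≤G k∈K)))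
    where
    open GroupProperties (AbelianGroup.group (𝔾 r)) using (//-rightDividesʳ; identityʳ-unique)
    t = 0V r , 1ℙ

  -- The leading coordinate 1 keeps every `f i` away from the missing element, while `(b i , c i)`
  -- runs through all four pairs of bits.
  four-elements : r ≥ 1 → Σ[ f ∈ (Fin 4 → Carrier) ] (∀ i → f i ∈ A-A) × Injective _≡_ _≈_ f
  four-elements (s≤s {n = r′} _) = f , (λ i → A-A⊇ λ { (() , _) }) , injective
    where
    b c : Fin 4 → 𝔽₂
    b = λ { 0F → 0ℙ ; 1F → 0ℙ ; 2F → 1ℙ ; 3F → 1ℙ }
    c = λ { 0F → 0ℙ ; 1F → 1ℙ ; 2F → 0ℙ ; 3F → 1ℙ }

    f : Fin 4 → Carrier
    f i = 1ℙ ∷ replicate _ (b i) , c i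

    code : 𝔽₂ → 𝔽₂ → Fin 4
    code 0ℙ 0ℙ = 0F
    code 0ℙ 1ℙ = 1F
    code 1ℙ 0ℙ = 2F
    code 1ℙ 1ℙ = 3F

    code-bc : ∀ i → code (b i) (c i) ≡ i
    code-bc 0F = refl
    code-bc 1F = refl
    code-bc 2F = refl
    code-bc 3F = refl

    injective : Injective _≡_ _≈_ f
    injective {i} {j} (v≡w , cᵢ≡cⱼ) =
      trans (sym (code-bc i)) (trans (cong₂ code bᵢ≡bⱼ cᵢ≡cⱼ) (code-bc j))
      where
      -- The bit is read off at y₁, the first coordinate of the second half, which is entry
      -- `r′ ↑ʳ zero` of the constant tail.
      bᵢ≡bⱼ : b i ≡ b j
      bᵢ≡bⱼ = begin
        b i                                       ≡⟨ Vec.lookup-replicate (r′ ↑ʳ zero) (b i) ⟨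
        lookup (replicate _ (b i)) (r′ ↑ʳ zero)   ≡⟨ cong (λ v → lookup v (suc (r′ ↑ʳ zero))) v≡w ⟩
        lookup (replicate _ (b j)) (r′ ↑ʳ zero)   ≡⟨ Vec.lookup-replicate (r′ ↑ʳ zero) (b j) ⟩
        b j                                       ∎
        where open ≡-Reasoning

theorem4p1 : (r : ℕ) → r ≥ 1 →
    let open AbelianGroup (𝔾 r) using (Carrier)
        open AbelianGroup (𝔾 r) using (_≈_)
        open AdditiveCombinatorics (𝔾 r)
        A   = graph r
        A-A = Member A ⊝ Member A
        r_A = rep (≈-dec r) A
    in (card A ≡ 2 ^ (2 * r))
     × (A-A ≐ (λ d → ¬ (d ≈ (0V r , 1ℙ))))
     × (r_A (0V r , 0ℙ) ≡ card A)
     × (∀ d → d ∈ A-A → ¬ (d ≈ (0V r , 0ℙ)) → 2 * r_A d ≡ card A)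
     × (∀ d → d ∈ A-A → card A ≤ 2 * r_A d)
     × (¬ IsSubgroup A-A)
     × (¬ (Σ[ K ∈ Pred Carrier 0ℓ ] IsSubgroup K × IsUnionOfCosets≤ 3 K A-A))
theorem4p1 r r≥1 =
    trans (card-A r) (trans (length-allVectors (r ℕ.+ r))
                            (cong (λ n → 2 ^ (r ℕ.+ n)) (sym (ℕ.+-identityʳ r))))
  , (A-A⊆ r , A-A⊇ r)
  , rep-0 r
  , 2*rep-nonzero r
  , card≤2*rep r
  , ¬subgroup r r≥1
  , λ (K , K≤G , A-A≐∪) →
      let f , f∈A-A , f-injective = four-elements r r≥1
      in trivial-coset-union-small (𝔾 r) (trivial-stabiliser r K≤G A-A≐∪) A-A≐∪ f∈A-A f-injective
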